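{- Consider the labelled transition system of the $\pi$-calculus in which the only rule for replication is: if $P\xrightarrow{\alpha}P'$ then $!P\xrightarrow{\alpha}P'\mid !P$ (that is, the rules S-Rep-Com and S-Rep-Close are absent), and let strong barbed similarity be defined with respect to this transition system. Then structural congruence is not included in strong barbed similarity: there exist processes $P,Q$ with $P\equiv Q$ such that $P$ is not strongly barbed similar to $Q$, i.e. no strong barbed simulation contains $(P,Q)$.
   Context: Syntax. Over an infinite set of names, processes are $P,Q ::= \mathbf 0 \mid x(y).P \mid \bar x y.P \mid (P\mid Q) \mid (\nu x)P \mid\ !P$. Input $x(y).P$ and restriction $(\nu y)P$ bind $y$ in $P$; all other name occurrences are free; processes are identified up to $\alpha$-equivalence; $\mathrm{fn}(P)$ is the set of free names. Actions: $\alpha ::= x(y)\mid \bar x y\mid \bar x(y)\mid\tau$ (input, free output, bound output, internal). In $x(y)$ and $\bar x(y)$ the name $y$ is bound; other occurrences are free. $\mathrm{fn}(\alpha),\mathrm{bn}(\alpha),\mathrm n(\alpha)$ denote free, bound, all names. Convention: in a transition $P\xrightarrow{\alpha}P'$ the bound name of $\alpha$ (if any) is fresh, i.e. $\mathrm{bn}(\alpha)\cap\mathrm{fn}(P)=\emptyset$; it may occur free in $P'$ and is regarded as binding there. Transition system used in this statement (least relations closed under): S-In: $x(z).P\xrightarrow{x(z)}P$. S-Out: $\bar xy.P\xrightarrow{\bar xy}P$. S-Par-L: if $P\xrightarrow{\alpha}P'$ and $\mathrm{bn}(\alpha)\cap\mathrm{fn}(Q)=\emptyset$ then $P\mid Q\xrightarrow{\alpha}P'\mid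 Q$; S-Par-R: symmetric. S-Com-L: if $P\xrightarrow{\bar xy}P'$ and $Q\xrightarrow{x(z)}Q'$ then $P\mid Q\xrightarrow{\tau}P'\mid Q'\{y/z\}$; S-Com-R: symmetric. S-Res: if $P\xrightarrow{\alpha}P'$ and $z\notin\mathrm n(\alpha)$ then $(\nu z)P\xrightarrow{\alpha}(\nu z)P'$. S-Open: if $P\xrightarrow{\bar xz}P'$ and $z\ne x$ then $(\nu z)P\xrightarrow{\bar x(z)}P'$. S-Close-L: if $P\xrightarrow{\bar x(z)}P'$ and $Q\xrightarrow{x(z)}Q'$ then $P\mid Q\xrightarrow{\tau}(\nu z)(P'\mid Q')$; S-Close-R: symmetric. S-Rep: if $P\xrightarrow{\alpha}P'$ then $!P\xrightarrow{\alpha}P'\mid !P$. (The two rules that are absent are S-Rep-Com: if $P\xrightarrow{\bar xy}P'$ and $P\xrightarrow{x(z)}P''$ then $!P\xrightarrow{\tau}(P'\mid P''\{y/z\})\mid !P$; and S-Rep-Close: if $P\xrightarrow{\bar x(z)}P'$ and $P\xrightarrow{x(z)}P''$ then $!P\xrightarrow{\tau}((\nu z)(P'\mid P''))\mid !P$.) Structural congruence $\equiv$ is the smallest equivalence relation on processes that is preserved by all constructors ($P\equiv Q$ implies $x(y).P\equiv x(y).Q$, $\bar xy.P\equiv\bar xy.Q$, $(\nu x)P\equiv(\nu x)Q$, $!P\equiv !Q$; and $P\equiv P',Q\equiv Q'$ imply $P\mid Q\equiv P'\mid Q'$) and satisfies $P\mid(Q\mid R)\equiv(P\mid Q)\mid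 R$; $P\mid\mathbf 0\equiv P$; $P\mid Q\equiv Q\mid P$; $(\nu x)\mathbf 0\equiv\mathbf 0$; $(\nu x)P\mid Q\equiv(\nu x)(P\mid Q)$ if $x\notin\mathrm{fn}(Q)$; $(\nu x)(\nu y)P\equiv(\nu y)(\nu x)P$; $!P\equiv P\mid !P$. Barbs: $P\downarrow_x$ iff $P\xrightarrow{x(z)}P'$ for some $z,P'$; $P\downarrow_{\bar x}$ iff $P\xrightarrow{\bar xy}P'$ or $P\xrightarrow{\bar x(z)}P'$ for some $y,z,P'$. A strong barbed simulation is a binary relation $\mathcal R$ on processes such that whenever $P\mathbin{\mathcal R}Q$: (1) $P\downarrow_x$ implies $Q\downarrow_x$ and $P\downarrow_{\bar x}$ implies $Q\downarrow_{\bar x}$, for all names $x$; (2) if $P\xrightarrow{\tau}P'$ then there is $Q'$ with $Q\xrightarrow{\tau}Q'$ and $P'\mathbin{\mathcal R}Q'$. Strong barbed similarity is the union of all strong barbed simulations. -}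

module Defs where

open import Data.Maybe.Base as Maybe using (Maybe; just; nothing; fromMaybe)
open import Data.Product.Base using (_×_; ∃-syntax)
open import Data.Sum.Base using (_⊎_)
open import Level using (0ℓ; suc)
open import Relation.Binary.Core using (Rel)

-- Processes up to α-equivalence: `Proc N` is the set of α-classes of processes
-- whose free names are drawn from N.  The scope of a binder is a process over
-- `Maybe N`, where `nothing` is the bound name and `just x` is the name x of
-- the enclosing scope.  Hence propositional equality is α-equivalence, and
-- z ∉ fn(Q), for z the name bound by an adjacent binder, is expressed by Q
-- occurring in that binder's scope as `wk Q`.

infixr 20 _∣_
infix  25 !_
infix  30 _[_]

data Proc (N : Set) : Set where
  𝟘   : Proc N
  inp : N → Proc (Maybe N) → Proc N
  out : N → N → Proc N → Proc N
  _∣_ : Proc N → Proc N → Proc N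
  ν   : Proc (Maybe N) → Proc N
  !_  : Proc N → Proc N

rename : {M N : Set} → (M → N) → Proc M → Proc N
rename ρ 𝟘           = 𝟘
rename ρ (inp x P)   = inp (ρ x) (rename (Maybe.map ρ) P)
rename ρ (out x y P) = out (ρ x) (ρ y) (rename ρ P)
rename ρ (P ∣ Q)     = rename ρ P ∣ rename ρ Q
rename ρ (ν P)       = ν (rename (Maybe.map ρ) P)
rename ρ (! P)       = ! rename ρ P

wk : {N : Set} → Proc N → Proc (Maybe N)
wk = rename just

-- P [ y ] is P{y/z}, where z is the name bound at P.
_[_] : {N : Set} → Proc (Maybe N) → N → Proc N
P [ y ] = rename (fromMaybe y) P

swapNames : {N : Set} → Maybe (Maybe N) → Maybe (Maybe N)
swapNames nothing         = just nothing
swapNames (just nothing)  = nothing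
swapNames (just (just x)) = just (just x)

-- Exchanges the names bound by the two innermost binders.
swap : {N : Set} → Proc (Maybe (Maybe N)) → Proc (Maybe (Maybe N))
swap = rename swapNames

-- The actions x(z), x̄y, x̄(z) and τ.  The bound name z of x(z) and x̄(z) is not
-- recorded in the action: it is fresh and binds in the target of the
-- transition, which therefore lives in the extended scope `Target α`.
data Act (N : Set) : Set where
  inpᵃ  : N → Act N
  outᵃ  : N → N → Act N
  boutᵃ : N → Act N
  τ     : Act N

Target : {N : Set} → Act N → Set
Target {N} (inpᵃ x)   = Maybe N
Target {N} (outᵃ x y) = N
Target {N} (boutᵃ x)  = Maybe N
Target {N} τ          = N

-- An action over N seen in the scope of a further binder.  An action over
-- `Maybe N` has the form `wkᵃ α` iff `nothing` is not among its free names.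
wkᵃ : {N : Set} → Act N → Act (Maybe N)
wkᵃ (inpᵃ x)   = inpᵃ (just x)
wkᵃ (outᵃ x y) = outᵃ (just x) (just y)
wkᵃ (boutᵃ x)  = boutᵃ (just x)
wkᵃ τ          = τ

-- A process not taking part in the action α, placed beside the target of α:
-- a bound name of α is not free in it.
idle : {N : Set} (α : Act N) → Proc N → Proc (Target α)
idle (inpᵃ x)   Q = wk Q
idle (outᵃ x y) Q = Q
idle (boutᵃ x)  Q = wk Q
idle τ          Q = Q

-- (νz)P' as the target of α, where P' is the target of α under the binder z.
-- In P' the name bound by α is innermost and z comes next; these change places
-- when the restriction of z is put around P'.
νᵗ : {N : Set} (α : Act N) → Proc (Target (wkᵃ α)) → Proc (Target α)
νᵗ (inpᵃ x)   P′ = ν (swap P′)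
νᵗ (outᵃ x y) P′ = ν P′
νᵗ (boutᵃ x)  P′ = ν (swap P′)
νᵗ τ          P′ = ν P′

infix 4 _—[_]→_

-- In S-Open the subject `just x` of the premise expresses z ≠ x.
data _—[_]→_ {N : Set} : Proc N → (α : Act N) → Proc (Target α) → Set where

  S-In : ∀ {x P} →
    inp x P —[ inpᵃ x ]→ P

  S-Out : ∀ {x y P} →
    out x y P —[ outᵃ x y ]→ P

  S-Par-L : ∀ {α P P′ Q} →
    P —[ α ]→ P′ →
    P ∣ Q —[ α ]→ P′ ∣ idle α Q

  S-Par-R : ∀ {α P Q Q′} →
    Q —[ α ]→ Q′ →
    P ∣ Q —[ α ]→ idle α P ∣ Q′

  S-Com-L : ∀ {x y P P′ Q Q′} →
    P —[ outᵃ x y ]→ P′ →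
    Q —[ inpᵃ x ]→ Q′ →
    P ∣ Q —[ τ ]→ P′ ∣ Q′ [ y ]

  S-Com-R : ∀ {x y P P′ Q Q′} →
    P —[ inpᵃ x ]→ P′ →
    Q —[ outᵃ x y ]→ Q′ →
    P ∣ Q —[ τ ]→ P′ [ y ] ∣ Q′

  S-Res : ∀ {α P P′} →
    P —[ wkᵃ α ]→ P′ →
    ν P —[ α ]→ νᵗ α P′

  S-Open : ∀ {x P P′} →
    P —[ outᵃ (just x) nothing ]→ P′ →
    ν P —[ boutᵃ x ]→ P′

  S-Close-L : ∀ {x P P′ Q Q′} →
    P —[ boutᵃ x ]→ P′ →
    Q —[ inpᵃ x ]→ Q′ →
    P ∣ Q —[ τ ]→ ν (P′ ∣ Q′)

  S-Close-R : ∀ {x P P′ Q Q′} →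
    P —[ inpᵃ x ]→ P′ →
    Q —[ boutᵃ x ]→ Q′ →
    P ∣ Q —[ τ ]→ ν (P′ ∣ Q′)

  S-Rep : ∀ {α P P′} →
    P —[ α ]→ P′ →
    ! P —[ α ]→ P′ ∣ idle α (! P)

infix 4 _≡ₛ_

-- Structural congruence.
data _≡ₛ_ {N : Set} : Rel (Proc N) 0ℓ where
  ≡ₛ-refl  : ∀ {P} → P ≡ₛ P
  ≡ₛ-sym   : ∀ {P Q} → P ≡ₛ Q → Q ≡ₛ P
  ≡ₛ-trans : ∀ {P Q R} → P ≡ₛ Q → Q ≡ₛ R → P ≡ₛ R

  inp-cong : ∀ {x P Q} → P ≡ₛ Q → inp x P ≡ₛ inp x Q
  out-cong : ∀ {x y P Q} → P ≡ₛ Q → out x y P ≡ₛ out x y Q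
  ν-cong   : ∀ {P Q} → P ≡ₛ Q → ν P ≡ₛ ν Q
  !-cong   : ∀ {P Q} → P ≡ₛ Q → ! P ≡ₛ ! Q
  ∣-cong   : ∀ {P P′ Q Q′} → P ≡ₛ P′ → Q ≡ₛ Q′ → P ∣ Q ≡ₛ P′ ∣ Q′

  ∣-assoc     : ∀ {P Q R} → P ∣ (Q ∣ R) ≡ₛ (P ∣ Q) ∣ R
  ∣-identityʳ : ∀ {P} → P ∣ 𝟘 ≡ₛ P
  ∣-comm      : ∀ {P Q} → P ∣ Q ≡ₛ Q ∣ P
  ν-𝟘         : ν 𝟘 ≡ₛ 𝟘
  ν-∣         : ∀ {P Q} → ν P ∣ Q ≡ₛ ν (P ∣ wk Q)
  ν-ν         : ∀ {P} → ν (ν P) ≡ₛ ν (ν (swap P))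
  !-unfold    : ∀ {P} → ! P ≡ₛ P ∣ ! P

_↓ⁱ_ : {N : Set} → Proc N → N → Set
P ↓ⁱ x = ∃[ P′ ] P —[ inpᵃ x ]→ P′

_↓ᵒ_ : {N : Set} → Proc N → N → Set
P ↓ᵒ x = (∃[ y ] ∃[ P′ ] P —[ outᵃ x y ]→ P′) ⊎ (∃[ P′ ] P —[ boutᵃ x ]→ P′)

record IsStrongBarbedSimulation {N : Set} (R : Rel (Proc N) 0ℓ) : Set where
  field
    barbⁱ : ∀ {P Q} → R P Q → ∀ x → P ↓ⁱ x → Q ↓ⁱ x
    barbᵒ : ∀ {P Q} → R P Q → ∀ x → P ↓ᵒ x → Q ↓ᵒ x
    step  : ∀ {P Q} → R P Q → ∀ {P′} → P —[ τ ]→ P′ →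
            ∃[ Q′ ] Q —[ τ ]→ Q′ × R P′ Q′

infix 4 _≲_

-- Strong barbed similarity.
_≲_ : {N : Set} → Rel (Proc N) (suc 0ℓ)
_≲_ {N} P Q = ∃[ R ] IsStrongBarbedSimulation {N} R × R P Q

{-# OPTIONS --safe #-}

-- Put R = (νs)(āa.s̄b ∣ a(_).s̄c ∣ s(z).z̄z).  In R ∣ !R the output on a of one
-- copy can meet the input on a of another copy; afterwards the inputs on the
-- private channels of the two copies serve s̄b and s̄c separately, so that three
-- τ-steps lead to a process with both barbs b̄ and c̄.  In !R, without the two
-- missing rules, a copy can only synchronise on a with itself; then s̄b and s̄c
-- compete for the only input on s, so a copy produces at most one of the two
-- barbs, at the price of two τ-steps, and both barbs together cost four.

module Submission where

open import Defs
open import Data.Empty using (⊥)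
open import Data.Maybe.Base using (Maybe; just; nothing)
open import Data.Nat.Base using (ℕ; suc; _+_; _≤_; s≤s)
open import Data.Nat.Properties using (+-suc; ≤-refl; ≤-trans; m≤m+n; m≤n+m; +-mono-≤)
open import Data.Product.Base using (_×_; _,_; ∃-syntax)
open import Data.Sum.Base using (_⊎_; inj₁; inj₂)
open import Function.Bundles using (_↣_; Injection)
open import Relation.Binary.PropositionalEquality using (_≡_; _≢_; refl; sym; trans)
open import Relation.Nullary.Negation.Core using (¬_; contradiction)

-- Computed by recursion on the process, so that on a concrete process a barb is refuted by
-- comparing names instead of inverting transitions.
InSubject : {N : Set} → Proc N → N → Set
InSubject 𝟘           x = ⊥
InSubject (inp y P)   x = x ≡ y
InSubject (out y z P) x = ⊥
InSubject (P ∣ Q)     x = InSubject P x ⊎ InSubject Q x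
InSubject (ν P)       x = InSubject P (just x)
InSubject (! P)       x = InSubject P x

OutSubject : {N : Set} → Proc N → N → Set
OutSubject 𝟘           x = ⊥
OutSubject (inp y P)   x = ⊥
OutSubject (out y z P) x = x ≡ y
OutSubject (P ∣ Q)     x = OutSubject P x ⊎ OutSubject Q x
OutSubject (ν P)       x = OutSubject P (just x)
OutSubject (! P)       x = OutSubject P x

inp⇒InSubject : {N : Set} {P : Proc N} {x : N} {P′ : Proc _} →
                P —[ inpᵃ x ]→ P′ → InSubject P x
inp⇒InSubject S-In        = refl
inp⇒InSubject (S-Par-L t) = inj₁ (inp⇒InSubject t)
inp⇒InSubject (S-Par-R t) = inj₂ (inp⇒InSubject t)
inp⇒InSubject (S-Res t)   = inp⇒InSubject t
inp⇒InSubject (S-Rep t)   = inp⇒InSubject t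

out⇒OutSubject : {N : Set} {P : Proc N} {x y : N} {P′ : Proc N} →
                 P —[ outᵃ x y ]→ P′ → OutSubject P x
out⇒OutSubject S-Out       = refl
out⇒OutSubject (S-Par-L t) = inj₁ (out⇒OutSubject t)
out⇒OutSubject (S-Par-R t) = inj₂ (out⇒OutSubject t)
out⇒OutSubject (S-Res t)   = out⇒OutSubject t
out⇒OutSubject (S-Rep t)   = out⇒OutSubject t

bout⇒OutSubject : {N : Set} {P : Proc N} {x : N} {P′ : Proc _} →
                  P —[ boutᵃ x ]→ P′ → OutSubject P x
bout⇒OutSubject (S-Par-L t) = inj₁ (bout⇒OutSubject t)
bout⇒OutSubject (S-Par-R t) = inj₂ (bout⇒OutSubject t)
bout⇒OutSubject (S-Res t)   = bout⇒OutSubject t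
bout⇒OutSubject (S-Open t)  = out⇒OutSubject t
bout⇒OutSubject (S-Rep t)   = bout⇒OutSubject t

↓ᵒ⇒OutSubject : {N : Set} {P : Proc N} {x : N} → P ↓ᵒ x → OutSubject P x
↓ᵒ⇒OutSubject (inj₁ (_ , _ , t)) = out⇒OutSubject t
↓ᵒ⇒OutSubject (inj₂ (_ , t))     = bout⇒OutSubject t

module Counterexample {N : Set} (a b c : N) (a≢b : a ≢ b) (a≢c : a ≢ c) (b≢c : b ≢ c) where

  forward : Proc (Maybe N)
  forward = inp nothing (out nothing nothing 𝟘)

  R : Proc N
  R = ν ((out (just a) (just a) (out nothing (just b) 𝟘)
         ∣ inp (just a) (out (just nothing) (just (just c)) 𝟘))
        ∣ forward)

  started sentᵇ sentᶜ : Proc N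
  started = ν ((out nothing (just b) 𝟘 ∣ out nothing (just c) 𝟘) ∣ forward)
  sentᵇ   = ν ((𝟘 ∣ out nothing (just c) 𝟘) ∣ out (just b) (just b) 𝟘)
  sentᶜ   = ν ((out nothing (just b) 𝟘 ∣ 𝟘) ∣ out (just c) (just c) 𝟘)

  -- The index counts the τ-steps that have been performed.
  data Copy : ℕ → Proc N → Set where
    isStarted : Copy 1 started
    isSentᵇ   : Copy 2 sentᵇ
    isSentᶜ   : Copy 2 sentᶜ

  -- Along τ-steps, replication spawns a copy only through a τ-step of `R` on its own, so every copy
  -- beside `! R` has already synchronised on `a`.
  data Pool : ℕ → Proc N → Set where
    rep : Pool 0 (! R)
    _∥_ : ∀ {k n U X} → Copy k U → Pool n X → Pool (k + n) (U ∣ X)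

  -- Both outputs on the private channel are still guarded by prefixes on `a`, so `forward` has no
  -- partner.
  R-τ : ∀ {P′} → R —[ τ ]→ P′ → P′ ≡ started
  R-τ (S-Res (S-Par-L (S-Par-L ())))
  R-τ (S-Res (S-Par-L (S-Par-R ())))
  R-τ (S-Res (S-Par-L (S-Com-L S-Out S-In))) = refl
  R-τ (S-Res (S-Par-R ()))
  R-τ (S-Res (S-Com-L (S-Par-L ()) S-In))
  R-τ (S-Res (S-Com-L (S-Par-R ()) S-In))
  R-τ (S-Res (S-Close-L (S-Par-L ()) _))
  R-τ (S-Res (S-Close-L (S-Par-R ()) _))

  copy-τ : ∀ {k U U′} → Copy k U → U —[ τ ]→ U′ → Copy (suc k) U′
  copy-τ isStarted (S-Res (S-Com-L (S-Par-L S-Out) S-In)) = isSentᵇ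
  copy-τ isStarted (S-Res (S-Com-L (S-Par-R S-Out) S-In)) = isSentᶜ
  copy-τ isStarted (S-Res (S-Par-L (S-Par-L ())))
  copy-τ isStarted (S-Res (S-Par-L (S-Par-R ())))
  copy-τ isStarted (S-Res (S-Close-L (S-Par-L ()) _))
  copy-τ isStarted (S-Res (S-Close-L (S-Par-R ()) _))
  copy-τ isSentᵇ (S-Res (S-Par-L (S-Par-L ())))
  copy-τ isSentᵇ (S-Res (S-Par-L (S-Par-R ())))
  copy-τ isSentᵇ (S-Res (S-Com-R (S-Par-L ()) _))
  copy-τ isSentᵇ (S-Res (S-Com-R (S-Par-R ()) _))
  copy-τ isSentᶜ (S-Res (S-Par-L (S-Par-L ())))
  copy-τ isSentᶜ (S-Res (S-Par-L (S-Par-R ())))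
  copy-τ isSentᶜ (S-Res (S-Com-R (S-Par-L ()) _))
  copy-τ isSentᶜ (S-Res (S-Com-R (S-Par-R ()) _))

  copy-no-input : ∀ {k U x} → Copy k U → ¬ InSubject U x
  copy-no-input isStarted (inj₁ (inj₁ ()))
  copy-no-input isStarted (inj₁ (inj₂ ()))
  copy-no-input isStarted (inj₂ ())
  copy-no-input isSentᵇ (inj₁ (inj₁ ()))
  copy-no-input isSentᵇ (inj₁ (inj₂ ()))
  copy-no-input isSentᶜ (inj₁ (inj₁ ()))
  copy-no-input isSentᶜ (inj₁ (inj₂ ()))

  barb : ∀ {k U} → Copy k U → N
  -- A default value: a started copy shows no output, and any name other than `a` would serve.
  barb isStarted = b
  barb isSentᵇ   = b
  barb isSentᶜ   = c

  a≢barb : ∀ {k U} (C : Copy k U) → a ≢ barb C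
  a≢barb isStarted = a≢b
  a≢barb isSentᵇ   = a≢b
  a≢barb isSentᶜ   = a≢c

  -- The losing output stays blocked on the private channel, so at most one barb is visible, and
  -- only after both τ-steps of the copy.
  copy-output : ∀ {k U x} (C : Copy k U) → OutSubject U x → x ≡ barb C × 2 ≤ k
  copy-output isStarted (inj₁ (inj₁ ()))
  copy-output isStarted (inj₁ (inj₂ ()))
  copy-output isSentᵇ   (inj₁ (inj₂ ()))
  copy-output isSentᵇ   (inj₂ refl) = refl , ≤-refl
  copy-output isSentᶜ   (inj₁ (inj₁ ()))
  copy-output isSentᶜ   (inj₂ refl) = refl , ≤-refl

  pool-input : ∀ {n X x} → Pool n X → InSubject X x → x ≡ a
  pool-input rep (inj₁ (inj₁ ()))
  pool-input rep (inj₁ (inj₂ refl)) = refl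
  pool-input rep (inj₂ ())
  pool-input (C ∥ D) (inj₁ i) = contradiction i (copy-no-input C)
  pool-input (C ∥ D) (inj₂ i) = pool-input D i

  -- Copies emit only on `b` or `c`, whereas the inputs of a pool all come from `! R` and are on
  -- `a`.
  copy-pool-apart : ∀ {k n U X x} → Copy k U → Pool n X →
                    OutSubject U x → ¬ InSubject X x
  copy-pool-apart C D o i with copy-output C o
  ... | x≡barb , _ = a≢barb C (trans (sym (pool-input D i)) x≡barb)

  -- Copies interact neither with each other nor with `! R`, so each τ-step advances one copy or
  -- starts a new one.
  pool-τ : ∀ {n X X′} → Pool n X → X —[ τ ]→ X′ → Pool (suc n) X′
  pool-τ rep (S-Rep t) with R-τ t
  ... | refl = isStarted ∥ rep
  pool-τ (C ∥ D) (S-Par-L t) = copy-τ C t ∥ D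
  pool-τ (_∥_ {k} {n} C D) (S-Par-R t) rewrite sym (+-suc k n) = C ∥ pool-τ D t
  pool-τ (C ∥ D) (S-Com-L o i) =
    contradiction (inp⇒InSubject i) (copy-pool-apart C D (out⇒OutSubject o))
  pool-τ (C ∥ D) (S-Com-R i o) = contradiction (inp⇒InSubject i) (copy-no-input C)
  pool-τ (C ∥ D) (S-Close-L o i) =
    contradiction (inp⇒InSubject i) (copy-pool-apart C D (bout⇒OutSubject o))
  pool-τ (C ∥ D) (S-Close-R i o) = contradiction (inp⇒InSubject i) (copy-no-input C)

  -- The name `a` is excluded because `! R` offers it before any step.
  pool-output : ∀ {n X x} → Pool n X → a ≢ x → OutSubject X x → 2 ≤ n
  pool-output rep a≢x (inj₁ (inj₁ refl)) = contradiction refl a≢x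
  pool-output rep a≢x (inj₁ (inj₂ ()))
  pool-output (_∥_ {k} {n} C D) a≢x (inj₁ o) with copy-output C o
  ... | _ , 2≤k = ≤-trans 2≤k (m≤m+n k n)
  pool-output (_∥_ {k} {n} C D) a≢x (inj₂ o) = ≤-trans (pool-output D a≢x o) (m≤n+m n k)

  -- The two barbs come from two different copies, each of which has cost two τ-steps.
  pool-outputs : ∀ {n X} → Pool n X → OutSubject X b → OutSubject X c → 4 ≤ n
  pool-outputs rep (inj₁ (inj₁ refl)) _ = contradiction refl a≢b
  pool-outputs rep (inj₁ (inj₂ ())) _
  pool-outputs (C ∥ D) (inj₁ o) (inj₁ o′) with copy-output C o | copy-output C o′
  ... | b≡barb , _ | c≡barb , _ = contradiction (trans b≡barb (sym c≡barb)) b≢c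
  pool-outputs (C ∥ D) (inj₁ o) (inj₂ o′) with copy-output C o
  ... | _ , 2≤k = +-mono-≤ 2≤k (pool-output D a≢c o′)
  pool-outputs (C ∥ D) (inj₂ o) (inj₁ o′) with copy-output C o′
  ... | _ , 2≤k = +-mono-≤ 2≤k (pool-output D a≢b o)
  pool-outputs (_∥_ {k} {n} C D) (inj₂ o) (inj₂ o′) =
    ≤-trans (pool-outputs D o o′) (m≤n+m n k)

  R∣!R≴!R : ¬ (R ∣ ! R ≲ ! R)
  R∣!R≴!R (_ , isSimulation , r₀) =
    let
      open IsStrongBarbedSimulation isSimulation
      _ , t₁ , r₁ = step r₀
        -- Synchronisation across copies: the lone `R` sends on `a` to a copy unfolded from `! R`,
        -- and each keeps its own `forward`.
        (S-Com-L (S-Res (S-Par-L (S-Par-L S-Out)))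
                 (S-Rep (S-Res (S-Par-L (S-Par-R S-In)))))
      _ , t₂ , r₂ = step r₁
        -- The `forward` of the first copy serves `b`; in the step after this, that of the second
        -- copy serves `c`.
        (S-Par-L (S-Res (S-Com-L (S-Par-L S-Out) S-In)))
      _ , t₃ , r₃ = step r₂
        (S-Par-R (S-Par-L (S-Res (S-Com-L (S-Par-R S-Out) S-In))))
      barbᵇ = barbᵒ r₃ b (inj₁ (_ , _ , S-Par-L (S-Res (S-Par-R S-Out))))
      barbᶜ = barbᵒ r₃ c (inj₁ (_ , _ , S-Par-R (S-Par-L (S-Res (S-Par-R S-Out)))))
    -- Three steps were matched, but both barbs require at least four.
    in contradiction
         (pool-outputs (pool-τ (pool-τ (pool-τ rep t₁) t₂) t₃)
                       (↓ᵒ⇒OutSubject barbᵇ) (↓ᵒ⇒OutSubject barbᶜ))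
         λ { (s≤s (s≤s (s≤s ()))) }

mainTheorem2 : (N : Set) → ℕ ↣ N → ∃[ P ] ∃[ Q ] (_≡ₛ_ {N} P Q × ¬ (P ≲ Q))
mainTheorem2 N f = R ∣ ! R , ! R , ≡ₛ-sym !-unfold , R∣!R≴!R
  where
  open Injection f

  to-≢ : ∀ {m n} → m ≢ n → to m ≢ to n
  to-≢ m≢n e = m≢n (injective e)

  open Counterexample (to 0) (to 1) (to 2) (to-≢ λ ()) (to-≢ λ ()) (to-≢ λ ())
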